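{- Let $\mathfrak M_i$ and $\mathfrak N_i$ ($1\le i\le k$) be $\mathsf{FO(TC^1)}$-Henkin structures over $\sigma$, the $\mathfrak M_i$ with pairwise disjoint domains and the $\mathfrak N_i$ with pairwise disjoint domains. For $1\le i\le k$ let $\bar a_i,\bar b_i$ be sequences of first-order parameters $a_{i_1},\ldots,a_{i_m}$ in $\mathfrak M_i$ and $b_{i_1},\ldots,b_{i_m}$ in $\mathfrak N_i$ (with $m$ possibly depending on $i$), where each sequence $\bar a_i$ (respectively $\bar b_i$) contains at least two distinct elements unless $\mathfrak M_i$ (respectively $\mathfrak N_i$) has only one element. If $(\mathfrak M_i,\bar a_i)\equiv^n_{\mathsf{FO(TC^1)}}(\mathfrak N_i,\bar b_i)$ for all $1\le i\le k$, then $$\Big(\bigoplus^f_{1\le i\le k}\mathfrak M_i,\bar a_1,\ldots,\bar a_k\Big)\equiv^n_{\mathsf{FO(TC^1)}}\Big(\bigoplus^f_{1\le i\le k}\mathfrak N_i,\bar b_1,\ldots,\bar b_k\Big).$$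
   Context: $\mathsf{FO(TC^1)}$ extends first-order logic with formulas $[TC_{xy}\varphi](u,v)$; quantifier depth counts nested first-order quantifiers and $TC$ operators; $\equiv^n_{\mathsf{FO(TC^1)}}$ between parametrized structures means satisfying the same $\mathsf{FO(TC^1)}$-formulas of quantifier depth at most $n$ with corresponding parameters. Henkin semantics: a frame is a relational structure $\mathfrak M$ with admissible sets $\mathbb A_{\mathfrak M}\subseteq\wp(dom(\mathfrak M))$; $[TC_{xy}\varphi](u,v)$ holds under $g$ iff $g(v)$ belongs to every $A\in\mathbb A_{\mathfrak M}$ with $g(u)\in A$ that is closed under $\varphi$ ($a\in A$ and $\mathfrak M,g[a/x,b/y]\models\varphi$ imply $b\in A$). An $\mathsf{FO(TC^1)}$-Henkin structure is a frame in which every set $\{a:\mathfrak M,g[a/x]\models\varphi\}$ ($\varphi$ an $\mathsf{FO(TC^1)}$-formula) is admissible. Fusion. $\sigma$ is purely relational, $\sigma^*=\sigma\cup\{Q_1,\ldots,Q_k\}$ with new unary $Q_i$, and $f$ maps each $n$-ary $P\in\sigma$ to a quantifier-free first-order $\sigma^*$-formula in $x_1,\ldots,x_n$. For structures with pairwise disjoint domains, $\biguplus_i\mathfrak M_i$ is the $\sigma^*$-frame with domain $\bigcup_idom(\mathfrak M_i)$, $P\in\sigma$ interpreted as $\bigcup_iP^{\mathfrak M_i}$, $Q_i$ as $dom(\mathfrak M_i)$, admissible sets the sets $\bigcup_iA_i$ with $A_i\in\mathbb A_{\mathfrak M_i}$. The $f$-fusion $\bigoplus^f_i\mathfrak M_i$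 is the $\sigma$-frame with the same domain and admissible sets, each $P\in\sigma$ interpreted as the tuples satisfying $f(P)$ in $\biguplus_i\mathfrak M_i$. -}

module Defs where

open import Data.Nat using (ℕ; zero; suc; _+_; _⊔_; _≤_)
open import Data.Fin using (Fin; zero; suc)
open import Data.Vec using (Vec; []; _∷_; lookup; map; _++_)
open import Data.Product using (Σ; _×_; _,_; proj₁; proj₂)
open import Data.Empty using (⊥)
open import Data.Sum using (_⊎_)
open import Function using (_∘_)
open import Relation.Binary.PropositionalEquality using (_≡_; _≢_)

record Signature : Set₁ where
  field
    Sym   : Set
    arity : Sym → ℕ
open Signature public

-- Frames (Henkin semantics).  The collection of admissible sets is
-- given as an indexed family  Adm : Idx → Dom → Set  (the admissible
-- sets are exactly the predicates  Adm i,  i : Idx).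

record Frame (σ : Signature) : Set₁ where
  field
    Dom : Set
    Rel : (P : Sym σ) → Vec Dom (arity σ P) → Set
    Idx : Set
    Adm : Idx → Dom → Set
open Frame public

-- FO(TC^1) formulas, scoped de Bruijn: Fm σ m has free variables among
-- Fin m.  In  tc φ u v  the formula φ : Fm σ (2+m) binds x = variable 0
-- and y = variable 1.

data Fm (σ : Signature) : ℕ → Set where
  rel : ∀ {m} (P : Sym σ) → Vec (Fin m) (arity σ P) → Fm σ m
  eq  : ∀ {m} → Fin m → Fin m → Fm σ m
  neg : ∀ {m} → Fm σ m → Fm σ m
  and : ∀ {m} → Fm σ m → Fm σ m → Fm σ m
  ex  : ∀ {m} → Fm σ (suc m) → Fm σ m
  tc  : ∀ {m} → Fm σ (suc (suc m)) → Fin m → Fin m → Fm σ m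

qd : ∀ {σ m} → Fm σ m → ℕ
qd (rel P xs) = 0
qd (eq x y)   = 0
qd (neg φ)    = qd φ
qd (and φ ψ)  = qd φ ⊔ qd ψ
qd (ex φ)     = suc (qd φ)
qd (tc φ u v) = suc (qd φ)

Sat : ∀ {σ m} (M : Frame σ) → Fm σ m → Vec (Dom M) m → Set
Sat M (rel P xs) g = Rel M P (map (λ x → lookup g x) xs)
Sat M (eq x y)   g = lookup g x ≡ lookup g y
Sat M (neg φ)    g = Sat M φ g → ⊥
Sat M (and φ ψ)  g = Sat M φ g × Sat M ψ g
Sat M (ex φ)     g = Σ (Dom M) λ a → Sat M φ (a ∷ g)
Sat M (tc φ u v) g =
  (i : Idx M) →
  ((a b : Dom M) → Adm M i a → Sat M φ (a ∷ b ∷ g) → Adm M i b) →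
  Adm M i (lookup g u) → Adm M i (lookup g v)

IsHenkin : ∀ {σ} → Frame σ → Set
IsHenkin M = ∀ {m} (φ : Fm _ (suc m)) (g : Vec (Dom M) m) →
  Σ (Idx M) λ i → (a : Dom M) →
    (Adm M i a → Sat M φ (a ∷ g)) × (Sat M φ (a ∷ g) → Adm M i a)

EquivN : ∀ {σ m} → ℕ → (M : Frame σ) → Vec (Dom M) m →
         (N : Frame σ) → Vec (Dom N) m → Set
EquivN {σ} {m} n M a N b = (φ : Fm σ m) → qd φ ≤ n →
  (Sat M φ a → Sat N φ b) × (Sat N φ b → Sat M φ a)

-- Fusion.  Quantifier-free first-order σ*-formulas in n variables,
-- σ* = σ ∪ {Q_1,…,Q_k}.

data QF (σ : Signature) (k n : ℕ) : Set where
  qrel : (P : Sym σ) → Vec (Fin n) (arity σ P) → QF σ k n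
  qQ   : Fin k → Fin n → QF σ k n
  qeq  : Fin n → Fin n → QF σ k n
  qneg : QF σ k n → QF σ k n
  qand : QF σ k n → QF σ k n → QF σ k n

FusionMap : Signature → ℕ → Set
FusionMap σ k = (P : Sym σ) → QF σ k (arity σ P)

-- domain of the disjoint union (disjointness of the domains is built in)
UDom : ∀ {σ k} → (Fin k → Frame σ) → Set
UDom {k = k} M = Σ (Fin k) (λ i → Dom (M i))

URel : ∀ {σ k} (M : Fin k → Frame σ) (P : Sym σ) → Vec (UDom M) (arity σ P) → Set
URel {σ} {k} M P t =
  Σ (Fin k) λ i → Σ (Vec (Dom (M i)) (arity σ P)) λ ds →
    (t ≡ map (i ,_) ds) × Rel (M i) P ds

SatU : ∀ {σ k n} (M : Fin k → Frame σ) → QF σ k n → Vec (UDom M) n → Set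
SatU M (qrel P xs) g = URel M P (map (λ x → lookup g x) xs)
SatU M (qQ i x) g = proj₁ (lookup g x) ≡ i
SatU M (qeq x y)   g = lookup g x ≡ lookup g y
SatU M (qneg φ)    g = SatU M φ g → ⊥
SatU M (qand φ ψ)  g = SatU M φ g × SatU M ψ g

-- the f-fusion ⊕^f_i M_i ; admissible sets are ⋃_i A_i with A_i ∈ 𝔸_{M_i}
fusion : ∀ {σ k} → FusionMap σ k → (Fin k → Frame σ) → Frame σ
fusion {σ} {k} f M = record
  { Dom = UDom M
  ; Rel = λ P t → SatU M (f P) t
  ; Idx = (i : Fin k) → Idx (M i)
  ; Adm = λ h p → Adm (M (proj₁ p)) (h (proj₁ p)) (proj₂ p)
  }

∑ : (k : ℕ) → (Fin k → ℕ) → ℕ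
∑ zero    m = 0
∑ (suc k) m = m zero + ∑ k (m ∘ suc)

concatParams : (k : ℕ) (D : Fin k → Set) (m : Fin k → ℕ) →
  ((i : Fin k) → Vec (D i) (m i)) → Vec (Σ (Fin k) D) (∑ k m)
concatParams zero    D m a = []
concatParams (suc k) D m a =
  map (zero ,_) (a zero) ++
  map (λ p → suc (proj₁ p) , proj₂ p) (concatParams k (D ∘ suc) (m ∘ suc) (a ∘ suc))

GoodParams : ∀ {m} (D : Set) → Vec D m → Set
GoodParams {m} D a =
  (Σ (Fin m) λ j → Σ (Fin m) λ j' → lookup a j ≢ lookup a j')
  ⊎ (Σ D λ c → (x : D) → x ≡ c)

{-# OPTIONS --safe #-}
module Submission where

-- Feferman–Vaught: for every formula φ over the fusion there is a finite list `frms φ` of component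
-- formulas, of no larger quantifier depth, such that componentwise agreement on the lists transfers
-- φ from one fusion to the other.  Working with the lists rather than with all formulas of depth n
-- allows σ to be infinite.
--
-- The interesting case is TC.  An admissible set of the fusion splits into sets A of the components,
-- and each A has to be answered by an admissible A′ in the other structure so that every element
-- inside A′, every element outside A′ and every pair crossing the boundary of A′ has the type of an
-- element inside A, outside A, or of a crossing pair of A: then a φ-edge leaving A′ would yield one
-- leaving A, also when its endpoints lie in different components.  If A separates two parameters
-- p and q, then ¬[TC θ](p,q) provides A′, where θ says "not the type of a crossing pair".
-- If A contains all parameters, it is first shrunk to its definable hull (the points TC-reachable
-- from p or q, so that the Henkin property makes the next set admissible), then q is removed; the
-- resulting set separates p from q, and q is added back on the other side.  If A contains no
-- parameter, dually for the points from which p or q is reachable.  These cases use the two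
-- distinct parameters.

open import Defs
open import Level using (0ℓ)
open import Axiom.ExcludedMiddle using (ExcludedMiddle)
open import Data.Nat using (ℕ; zero; suc; _⊔_; _≤_; z≤n; s≤s)
open import Data.Nat.Properties using (≤-trans; ≤-reflexive; ⊔-lub; m≤m⊔n; m≤n⊔m)
open import Data.Fin using (Fin; zero; suc; lift; splitAt; _≟_)
open import Data.Vec using (Vec; []; _∷_; lookup; map; _++_)
open import Data.Vec.Properties using (lookup-map; lookup-splitAt; map-cong; map-∘)
open import Data.List as List using (List; []; _∷_; allFin; cartesianProduct; cartesianProductWith)
open import Data.List.Membership.Propositional using (_∈_)
open import Data.List.Membership.Propositional.Properties
  using (∈-map⁺; ∈-map⁻; ∈-++⁺ˡ; ∈-++⁺ʳ; ∈-++⁻; ∈-allFin;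
    ∈-cartesianProduct⁺; ∈-cartesianProductWith⁺)
open import Data.List.Relation.Unary.Any using (here; there)
open import Data.Product using (Σ; Σ-syntax; ∃-syntax; _×_; _,_; proj₁; proj₂)
open import Data.Product.Function.NonDependent.Propositional using (_×-⇔_)
open import Data.Product.Properties using (,-injectiveʳ-UIP)
open import Data.Empty using (⊥-elim)
open import Data.Sum using (_⊎_; inj₁; inj₂; [_,_]′)
open import Data.Sum.Function.Propositional using (_⊎-⇔_)
open import Function using (_∘_; id; _⇔_; mk⇔; Equivalence)
open import Function.Construct.Symmetry using (⇔-sym)
open import Function.Construct.Composition using (_⇔-∘_)
open import Axiom.UniquenessOfIdentityProofs.WithK using (uip)
open import Relation.Nullary using (¬_; Dec; yes; no)
open import Relation.Nullary.Decidable using (decidable-stable)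
open import Relation.Binary.PropositionalEquality
  using (_≡_; _≢_; refl; sym; trans; cong; cong₂; subst; subst₂)

open Equivalence using (to; from)

-- Negation and finite lists of variable tuples.

neg-⇔ : {A B : Set} → A ⇔ B → (¬ A) ⇔ (¬ B)
neg-⇔ e = mk⇔ (λ ¬a b → ¬a (from e b)) (λ ¬b a → ¬b (to e a))

allVecs : ∀ m r → List (Vec (Fin m) r)
allVecs m zero    = [] ∷ []
allVecs m (suc r) = cartesianProductWith _∷_ (allFin m) (allVecs m r)

∈-allVecs : ∀ {m r} (v : Vec (Fin m) r) → v ∈ allVecs m r
∈-allVecs []      = here refl
∈-allVecs (x ∷ v) = ∈-cartesianProductWith⁺ _∷_ (∈-allFin x) (∈-allVecs v)

module _ {σ : Signature} where

  -- Renaming of variables.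

  ren : ∀ {m r} → (Fin m → Fin r) → Fm σ m → Fm σ r
  ren ρ (rel P xs) = rel P (map ρ xs)
  ren ρ (eq x y)   = eq (ρ x) (ρ y)
  ren ρ (neg φ)    = neg (ren ρ φ)
  ren ρ (and φ ψ)  = and (ren ρ φ) (ren ρ ψ)
  ren ρ (ex φ)     = ex (ren (lift 1 ρ) φ)
  ren ρ (tc φ u v) = tc (ren (lift 2 ρ) φ) (ρ u) (ρ v)

  qd-ren : ∀ {m r} (ρ : Fin m → Fin r) (φ : Fm σ m) → qd (ren ρ φ) ≡ qd φ
  qd-ren ρ (rel P xs) = refl
  qd-ren ρ (eq x y)   = refl
  qd-ren ρ (neg φ)    = qd-ren ρ φ
  qd-ren ρ (and φ ψ)  = cong₂ _⊔_ (qd-ren ρ φ) (qd-ren ρ ψ)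
  qd-ren ρ (ex φ)     = cong suc (qd-ren (lift 1 ρ) φ)
  qd-ren ρ (tc φ u v) = cong suc (qd-ren (lift 2 ρ) φ)

  Along : ∀ {D : Set} {m r} → (Fin m → Fin r) → Vec D r → Vec D m → Set
  Along ρ h g = ∀ j → lookup h (ρ j) ≡ lookup g j

  Along-lift₁ : ∀ {D : Set} {m r} {ρ : Fin m → Fin r} {h : Vec D r} {g : Vec D m} →
    Along ρ h g → ∀ x → Along (lift 1 ρ) (x ∷ h) (x ∷ g)
  Along-lift₁ al x zero    = refl
  Along-lift₁ al x (suc j) = al j

  Along-lift₂ : ∀ {D : Set} {m r} {ρ : Fin m → Fin r} {h : Vec D r} {g : Vec D m} →
    Along ρ h g → ∀ x y → Along (lift 2 ρ) (x ∷ y ∷ h) (x ∷ y ∷ g)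
  Along-lift₂ al x y zero          = refl
  Along-lift₂ al x y (suc zero)    = refl
  Along-lift₂ al x y (suc (suc j)) = al j

  Sat-ren : ∀ (M : Frame σ) {m r} (ρ : Fin m → Fin r) (φ : Fm σ m)
    {h : Vec (Dom M) r} {g : Vec (Dom M) m} → Along ρ h g → Sat M (ren ρ φ) h ⇔ Sat M φ g
  Sat-ren M ρ (rel P xs) {h} {g} al = mk⇔ (subst (Rel M P) e) (subst (Rel M P) (sym e))
    where e = trans (sym (map-∘ (lookup h) ρ xs)) (map-cong al xs)
  Sat-ren M ρ (eq x y) al = mk⇔ (subst₂ _≡_ (al x) (al y))
                                (subst₂ _≡_ (sym (al x)) (sym (al y)))
  Sat-ren M ρ (neg φ) al = neg-⇔ (Sat-ren M ρ φ al)
  Sat-ren M ρ (and φ ψ) al = Sat-ren M ρ φ al ×-⇔ Sat-ren M ρ ψ al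
  Sat-ren M ρ (ex φ) al = mk⇔
    (λ (x , s) → x , to (Sat-ren M _ φ (Along-lift₁ al x)) s)
    (λ (x , s) → x , from (Sat-ren M _ φ (Along-lift₁ al x)) s)
  Sat-ren M ρ (tc φ u v) al = mk⇔
    (λ s i c i∋u → subst (Adm M i) (al v)
      (s i (λ x y i∋x t → c x y i∋x (to (Sat-ren M _ φ (Along-lift₂ al x y)) t))
        (subst (Adm M i) (sym (al u)) i∋u)))
    (λ s i c i∋u → subst (Adm M i) (sym (al v))
      (s i (λ x y i∋x t → c x y i∋x (from (Sat-ren M _ φ (Along-lift₂ al x y)) t))
        (subst (Adm M i) (al u) i∋u)))

  -- Formulas of bounded quantifier depth.

  Frm : ℕ → ℕ → Set
  Frm n m = Σ[ φ ∈ Fm σ m ] qd φ ≤ n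

  Holds : ∀ (M : Frame σ) {n m} → Frm n m → Vec (Dom M) m → Set
  Holds M δ g = Sat M (proj₁ δ) g

  relF : ∀ {n m} (P : Sym σ) → Vec (Fin m) (arity σ P) → Frm n m
  relF P xs = rel P xs , z≤n

  eqF : ∀ {n m} → Fin m → Fin m → Frm n m
  eqF x y = eq x y , z≤n

  ⊤F : ∀ {n m} → Frm n (suc m)
  ⊤F = eqF zero zero

  negF : ∀ {n m} → Frm n m → Frm n m
  negF (φ , p) = neg φ , p

  andF orF : ∀ {n m} → Frm n m → Frm n m → Frm n m
  andF (φ , p) (ψ , q) = and φ ψ , ⊔-lub p q
  orF φ ψ = negF (andF (negF φ) (negF ψ))

  exF : ∀ {n m} → Frm n (suc m) → Frm (suc n) m
  exF (φ , p) = ex φ , s≤s p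

  allF : ∀ {n m} → Frm n (suc m) → Frm (suc n) m
  allF φ = negF (exF (negF φ))

  tcF : ∀ {n m} → Frm n (suc (suc m)) → Fin m → Fin m → Frm (suc n) m
  tcF (φ , p) u v = tc φ u v , s≤s p

  instRen : ∀ {m r} → (Fin m → Fin r) → Fin r → Fin r → Fin (suc (suc m)) → Fin r
  instRen w s t zero          = s
  instRen w s t (suc zero)    = t
  instRen w s t (suc (suc j)) = w j

  -- Replacing variables costs no depth. Thus χ(x, y) can also be read on the diagonal, or with a
  -- parameter in either place.
  inst : ∀ {n m r} → (Fin m → Fin r) → Fin r → Fin r → Frm n (suc (suc m)) → Frm n r
  inst w s t (φ , p) = ren (instRen w s t) φ , ≤-trans (≤-reflexive (qd-ren _ φ)) p

  Holds-inst : ∀ (M : Frame σ) {n m r} {w : Fin m → Fin r} (s t : Fin r) (χ : Frm n (suc (suc m)))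
    {h : Vec (Dom M) r} {a : Vec (Dom M) m} → Along w h a →
    Holds M (inst w s t χ) h ⇔ Holds M χ (lookup h s ∷ lookup h t ∷ a)
  Holds-inst M {w = w} s t (φ , _) {h} {a} al = Sat-ren M _ φ al′
    where
    al′ : Along (instRen w s t) h (lookup h s ∷ lookup h t ∷ a)
    al′ zero          = refl
    al′ (suc zero)    = refl
    al′ (suc (suc j)) = al j

  -- Agreement on a list of formulas, and types.

  record Agree {n m} (Δ : List (Frm n m)) (M : Frame σ) (a : Vec (Dom M) m)
    (N : Frame σ) (b : Vec (Dom N) m) : Set where
    constructor agree
    field
      holds⇔ : ∀ {δ} → δ ∈ Δ → Holds M δ a ⇔ Holds N δ b
  open Agree public

  Agree-sym : ∀ {n m} {Δ : List (Frm n m)} {M N a b} → Agree Δ M a N b → Agree Δ N b M a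
  Agree-sym ag = agree λ δ∈ → ⇔-sym (holds⇔ ag δ∈)

  Agree-⊆ : ∀ {n m} {Δ Δ′ : List (Frm n m)} {M N a b} →
    (∀ {δ} → δ ∈ Δ → δ ∈ Δ′) → Agree Δ′ M a N b → Agree Δ M a N b
  Agree-⊆ sub ag = agree (holds⇔ ag ∘ sub)

  -- Scope m = 0 is excluded since ⊤ need not exist there at depth 0.
  types : ∀ {n m} → List (Frm n (suc m)) → List (Frm n (suc m))
  types []      = ⊤F ∷ []
  types (δ ∷ Δ) = List.map (andF δ) (types Δ) List.++ List.map (andF (negF δ)) (types Δ)

  unions : ∀ {n m} → List (Frm n (suc m)) → List (Frm n (suc m))
  unions []      = negF ⊤F ∷ []
  unions (τ ∷ T) = unions T List.++ List.map (orF τ) (unions T)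

  -- Up to equivalence, all Boolean combinations of Δ: finitely many, with the same depth bound.
  typeSets : ∀ {n m} → List (Frm n (suc m)) → List (Frm n (suc m))
  typeSets = unions ∘ types

  types-sound : ∀ {n m} (Δ : List (Frm n (suc m))) {τ} → τ ∈ types Δ →
    ∀ {M N g h} → Holds M τ g → Holds N τ h →
    ∀ {δ} → δ ∈ Δ → Holds M δ g ⇔ Holds N δ h
  types-sound (δ ∷ Δ) τ∈ sM sN δ′∈ with ∈-++⁻ (List.map (andF δ) (types Δ)) τ∈
  ... | inj₁ τ∈ˡ with ∈-map⁻ (andF δ) τ∈ˡ
  types-sound (δ ∷ Δ) τ∈ sM sN (here refl) | inj₁ _ | τ , _ , refl =
    mk⇔ (λ _ → proj₁ sN) (λ _ → proj₁ sM)
  types-sound (δ ∷ Δ) τ∈ sM sN (there δ′∈) | inj₁ _ | τ , τ∈Δ , refl =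
    types-sound Δ τ∈Δ (proj₂ sM) (proj₂ sN) δ′∈
  types-sound (δ ∷ Δ) τ∈ sM sN δ′∈ | inj₂ τ∈ʳ with ∈-map⁻ (andF (negF δ)) τ∈ʳ
  types-sound (δ ∷ Δ) τ∈ sM sN (here refl) | inj₂ _ | τ , _ , refl =
    mk⇔ (⊥-elim ∘ proj₁ sM) (⊥-elim ∘ proj₁ sN)
  types-sound (δ ∷ Δ) τ∈ sM sN (there δ′∈) | inj₂ _ | τ , τ∈Δ , refl =
    types-sound Δ τ∈Δ (proj₂ sM) (proj₂ sN) δ′∈

  -- Reachability and cuts in one structure.

  weak₂ : ∀ {m} → Fin m → Fin (suc (suc m))
  weak₂ j = suc (suc j)

  -- The TC runs along ¬ κ, so that a closed set is one all of whose crossing pairs satisfy κ.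
  pathF : ∀ {n m r} → Frm n (suc (suc m)) → (Fin m → Fin r) → Fin r → Fin r → Frm (suc n) r
  pathF κ w s t = tcF (negF (inst (weak₂ ∘ w) zero (suc zero) κ)) s t

  module _ (M : Frame σ) {m : ℕ} (a : Vec (Dom M) m) where

    -- Reachability in the Henkin sense: membership in every admissible closed set, so a path need
    -- not be a finite chain.
    Path : ∀ {n} → Frm n (suc (suc m)) → Dom M → Dom M → Set
    Path κ u v = (i : Idx M) →
      (∀ x y → Adm M i x → ¬ Holds M κ (x ∷ y ∷ a) → Adm M i y) →
      Adm M i u → Adm M i v

    Holds-path : ∀ {n r} (κ : Frm n (suc (suc m))) {w : Fin m → Fin r} (s t : Fin r)
      {h : Vec (Dom M) r} → Along w h a →
      Holds M (pathF κ w s t) h ⇔ Path κ (lookup h s) (lookup h t)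
    Holds-path κ {w} s t {h} al = mk⇔
      (λ q i c → q i (λ x y i∋x ¬κ → c x y i∋x (¬κ ∘ from (e x y))))
      (λ q i c → q i (λ x y i∋x ¬κ → c x y i∋x (¬κ ∘ to (e x y))))
      where
      e : ∀ x y → Holds M (inst (weak₂ ∘ w) zero (suc zero) κ) (x ∷ y ∷ h) ⇔ Holds M κ (x ∷ y ∷ a)
      e x y = Holds-inst M zero (suc zero) κ al

    Path-refl : ∀ {n} (κ : Frm n (suc (suc m))) {u} → Path κ u u
    Path-refl κ i c i∋u = i∋u

    Path-∷ʳ : ∀ {n} (κ : Frm n (suc (suc m))) {u x y} →
      Path κ u x → ¬ Holds M κ (x ∷ y ∷ a) → Path κ u y
    Path-∷ʳ κ p ¬κ i c i∋u = c _ _ (p i c i∋u) ¬κ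

    Path-∷ : ∀ {n} (κ : Frm n (suc (suc m))) {x y v} →
      ¬ Holds M κ (x ∷ y ∷ a) → Path κ y v → Path κ x v
    Path-∷ κ ¬κ p i c i∋x = p i c (c _ _ i∋x ¬κ)

    Crosses : ∀ {n} → Frm n (suc (suc m)) → (Dom M → Set) → Set
    Crosses κ A = ∀ {x y} → A x → ¬ A y → Holds M κ (x ∷ y ∷ a)

    -- Single elements appear as diagonal pairs, so that all three formulas can be drawn from one
    -- list. The diagonal conditions serve the components where one element fills both coordinates.
    record Cut {n} (χ χᵢ χₒ : Frm n (suc (suc m))) (A : Dom M → Set) : Set where
      field
        cross   : Crosses χ A
        inside  : ∀ {x} → A x → Holds M χᵢ (x ∷ x ∷ a)
        outside : ∀ {y} → ¬ A y → Holds M χₒ (y ∷ y ∷ a)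

    Cut-resp : ∀ {n} {χ χᵢ χₒ : Frm n (suc (suc m))} {A B : Dom M → Set} →
      (∀ x → A x ⇔ B x) → Cut χ χᵢ χₒ A → Cut χ χᵢ χₒ B
    Cut-resp e c = record
      { cross   = λ b ¬b → Cut.cross c (from (e _) b) (¬b ∘ to (e _))
      ; inside  = λ b → Cut.inside c (from (e _) b)
      ; outside = λ ¬b → Cut.outside c (¬b ∘ to (e _))
      }

  -- Formulas that define cuts.

  inst₂ : ∀ {n m} → Fin (suc (suc m)) → Fin (suc (suc m)) →
    Frm n (suc (suc m)) → Frm n (suc (suc m))
  inst₂ = inst weak₂

  module _ {n m : ℕ} (χ χᵢ χₒ : Frm n (suc (suc m))) where

    -- The diagonal conditions can be attached to crossing pairs: if a set has an element inside and
    -- one outside, every element belongs to such a pair.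
    edgeF : Frm n (suc (suc m))
    edgeF = andF χ (andF (inst₂ zero zero χᵢ) (inst₂ (suc zero) (suc zero) χₒ))

    -- If A contains p but not q and its crossing pairs satisfy `insertF q`, then A ∪ {q} is a cut;
    -- if A contains q but not p and its crossing pairs satisfy `deleteF q`, then A ∖ {q} is one.
    insertF deleteF : Fin m → Frm n (suc (suc m))
    insertF q = andF (orF (eqF (suc zero) (suc (suc q)))
                          (andF edgeF (inst₂ (suc (suc q)) (suc zero) edgeF)))
                     (andF (inst₂ zero zero χᵢ) (inst₂ (suc (suc q)) (suc (suc q)) χᵢ))
    deleteF q = andF (orF (eqF zero (suc (suc q)))
                          (andF edgeF (inst₂ zero (suc (suc q)) edgeF)))
                     (andF (inst₂ (suc zero) (suc zero) χₒ) (inst₂ (suc (suc q)) (suc (suc q)) χₒ))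

  Quintuple : ℕ → ℕ → Set
  Quintuple n m = (Frm n (suc (suc m)) × Frm n (suc (suc m)) × Frm n (suc (suc m))) × Fin m × Fin m

  quintuples : ∀ {n m} → List (Frm n (suc (suc m))) → List (Quintuple n m)
  quintuples B = cartesianProduct (cartesianProduct B (cartesianProduct B B))
                                  (cartesianProduct (allFin _) (allFin _))

  edgePath insertPath deletePath : ∀ {n m} → Quintuple n m → Frm (suc n) m
  edgePath   ((χ , χᵢ , χₒ) , p , q) = pathF (edgeF χ χᵢ χₒ) id p q
  insertPath ((χ , χᵢ , χₒ) , p , q) = pathF (insertF χ χᵢ χₒ q) id p q
  -- The path runs from q to p, as the set extended by q contains q and misses p.
  deletePath ((χ , χᵢ , χₒ) , p , q) = pathF (deleteF χ χᵢ χₒ q) id q p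

  -- Serves the whole domain and the empty set, which have no crossing pairs.
  diagF : ∀ {n m} → Frm n (suc (suc m)) → Frm (suc n) m
  diagF χ = allF (inst suc zero zero χ)

  cutFrms : ∀ {n m} → List (Frm n (suc (suc m))) → List (Frm (suc n) m)
  cutFrms B = List.map diagF B List.++ List.map edgePath (quintuples B) List.++
    List.map insertPath (quintuples B) List.++ List.map deletePath (quintuples B)

  -- Forces matching sets to agree on the parameters.
  markers : ∀ {n} m → List (Frm n (suc (suc m)))
  markers m = List.map (λ j → eqF zero (suc (suc j))) (allFin m)

-- Classical reasoning about types.

module Stability (em : ExcludedMiddle 0ℓ) where

  stable : {P : Set} → ¬ ¬ P → P
  stable = decidable-stable em

module Classical (em : ExcludedMiddle 0ℓ) {σ : Signature} where
  open Stability em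

  Holds-or : ∀ (M : Frame σ) {n m} (φ ψ : Frm n m) {g} →
    Holds M (orF φ ψ) g ⇔ (Holds M φ g ⊎ Holds M ψ g)
  Holds-or M φ ψ = mk⇔
    (λ s → stable λ ¬φψ → s ((¬φψ ∘ inj₁) , (¬φψ ∘ inj₂)))
    [ (λ x s → proj₁ s x) , (λ y s → proj₂ s y) ]′

  Holds-all : ∀ (M : Frame σ) {n m} (φ : Frm n (suc m)) {g} →
    Holds M (allF φ) g ⇔ (∀ x → Holds M φ (x ∷ g))
  Holds-all M φ = mk⇔ (λ s x → stable λ ¬φ → s (x , ¬φ)) (λ s (x , ¬φ) → ¬φ (s x))

  Holds-diag : ∀ (M : Frame σ) {n m} (ψ : Frm n (suc (suc m))) {a} →
    Holds M (diagF ψ) a ⇔ (∀ x → Holds M ψ (x ∷ x ∷ a))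
  Holds-diag M ψ = mk⇔ (λ s x → to (e x) (to (Holds-all M (inst suc zero zero ψ)) s x))
                       (λ s → from (Holds-all M (inst suc zero zero ψ)) λ x → from (e x) (s x))
    where e = λ x → Holds-inst M zero zero ψ {x ∷ _} (λ _ → refl)

  types-complete : ∀ {n m} (Δ : List (Frm n (suc m))) (M : Frame σ) g →
    ∃[ τ ] τ ∈ types Δ × Holds M τ g
  types-complete [] M g = ⊤F , here refl , refl
  types-complete (δ ∷ Δ) M g with types-complete Δ M g | em {Holds M δ g}
  ... | τ , τ∈ , s | yes d = _ , ∈-++⁺ˡ (∈-map⁺ (andF δ) τ∈) , d , s
  ... | τ , τ∈ , s | no ¬d =
    _ , ∈-++⁺ʳ (List.map (andF δ) (types Δ)) (∈-map⁺ (andF (negF δ)) τ∈) , ¬d , s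

  -- C may speak of one fixed frame, for instance of the types realised there. Excluded middle
  -- decides it on the finite list, and the disjunction obtained keeps its meaning in every frame N.
  union-of : ∀ {n m} (T : List (Frm n (suc m))) (C : Frm n (suc m) → Set) →
    ∃[ ψ ] ψ ∈ unions T × (∀ (N : Frame σ) h →
      Holds N ψ h ⇔ (∃[ τ ] τ ∈ T × C τ × Holds N τ h))
  union-of [] C = negF ⊤F , here refl , λ N h → mk⇔ (λ s → ⊥-elim (s refl)) (λ { (_ , () , _) })
  union-of (τ ∷ T) C with union-of T C | em {C τ}
  ... | ψ , ψ∈ , e | no ¬c = ψ , ∈-++⁺ˡ ψ∈ , λ N h → mk⇔
    (λ s → let (τ′ , τ′∈ , r) = to (e N h) s in τ′ , there τ′∈ , r)
    (λ { (_ , here refl , c , _) → ⊥-elim (¬c c)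
       ; (τ′ , there τ′∈ , r) → from (e N h) (τ′ , τ′∈ , r) })
  ... | ψ , ψ∈ , e | yes c = orF τ ψ , ∈-++⁺ʳ (unions T) (∈-map⁺ (orF τ) ψ∈) , λ N h → mk⇔
    (λ s → [ (λ t → τ , here refl , c , t)
           , (λ u → let (τ′ , τ′∈ , r) = to (e N h) u in τ′ , there τ′∈ , r) ]′
           (to (Holds-or N τ ψ) s))
    (λ { (_ , here refl , _ , t) → from (Holds-or N τ ψ) (inj₁ t)
       ; (τ′ , there τ′∈ , r) → from (Holds-or N τ ψ) (inj₂ (from (e N h) (τ′ , τ′∈ , r))) })

  -- The formula is the union of the types realised in X, so whatever satisfies it, in any frame,
  -- shares its type with a member of X.
  typeSet : ∀ {n m} (Δ : List (Frm n (suc m))) (M : Frame σ) (X : Vec (Dom M) (suc m) → Set) →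
    ∃[ ψ ] ψ ∈ typeSets Δ × (∀ {g} → X g → Holds M ψ g) ×
      (∀ (N : Frame σ) {h} → Holds N ψ h → ∃[ g ] X g × Agree Δ M g N h)
  typeSet Δ M X with union-of (types Δ) (λ τ → ∃[ g ] X g × Holds M τ g)
  ... | ψ , ψ∈ , e = ψ , ψ∈
    , (λ {g} x → let (τ , τ∈ , s) = types-complete Δ M g in from (e M g) (τ , τ∈ , (g , x , s) , s))
    , (λ N {h} s → let (τ , τ∈ , (g , x , t) , t′) = to (e N h) s in
        g , x , agree (types-sound Δ τ∈ {M} {N} t t′))

  -- The forth step: apply `typeSet` to the single tuple `x ∷ a` and transfer the existential
  -- closure of the formula.
  extend : ∀ {n m} (Δ : List (Frm n (suc m))) {M N : Frame σ} {a : Vec (Dom M) m} {b} →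
    Agree (List.map exF (typeSets Δ)) M a N b → ∀ x → ∃[ y ] Agree Δ M (x ∷ a) N (y ∷ b)
  extend Δ {M} {N} {a} ag x with typeSet Δ M (_≡ x ∷ a)
  ... | ψ , ψ∈ , s , r with to (holds⇔ ag (∈-map⁺ exF ψ∈)) (x , s refl)
  ... | y , t with r N t
  ... | _ , refl , ag′ = y , ag′

  -- Admissible sets and separation of parameters.

  Admits : (M : Frame σ) → (Dom M → Set) → Set
  Admits M A = ∃[ i ] ∀ x → Adm M i x ⇔ A x

  -- The Henkin property is applied only here.
  definable : ∀ {M : Frame σ} → IsHenkin M → ∀ {n m} (φ : Frm n (suc m)) (a : Vec (Dom M) m)
    {A : Dom M → Set} → (∀ x → Holds M φ (x ∷ a) ⇔ A x) → Admits M A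
  definable h (φ , _) a e = proj₁ (h φ a) ,
    λ x → e x ⇔-∘ mk⇔ (proj₁ (proj₂ (h φ a) x)) (proj₂ (proj₂ (h φ a) x))

  module _ {M : Frame σ} {m : ℕ} {a : Vec (Dom M) m} where

    -- By contraposition A is closed under steps violating κ, hence is one of the sets over which
    -- `Path` quantifies.
    Path-least : ∀ {n} (κ : Frm n (suc (suc m))) {A} → Admits M A → Crosses M a κ A →
      ∀ {u v} → Path M a κ u v → A u → A v
    Path-least κ (i , e) cr p u∈A = to (e _) (p i
      (λ x y i∋x ¬κ → stable λ i∌y → ¬κ (cr (to (e x) i∋x) (i∌y ∘ from (e y))))
      (from (e _) u∈A))

    -- A pair leaving the reachable set and violating κ would prolong the path.
    Crosses-reach : ∀ {n} (κ : Frm n (suc (suc m))) {u} → Crosses M a κ (Path M a κ u)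
    Crosses-reach κ p ¬p = stable λ ¬κ → ¬p (Path-∷ʳ M a κ p ¬κ)

  module _ {M N : Frame σ} {m : ℕ} {a : Vec (Dom M) m} {b : Vec (Dom N) m} where

    -- A path in N would transfer to M, where A contradicts it by `Path-least`.
    separate : ∀ {n} (κ : Frm n (suc (suc m))) p q {A} → Admits M A →
      Holds M (pathF κ id p q) a ⇔ Holds N (pathF κ id p q) b →
      Crosses M a κ A → A (lookup a p) → ¬ A (lookup a q) →
      ¬ Path N b κ (lookup b p) (lookup b q)
    separate κ p q adm e cr p∈A q∉A π = q∉A (Path-least κ adm cr π′ p∈A)
      where
      π′ = to (Holds-path M a κ p q (λ _ → refl))
             (from e (from (Holds-path N b κ p q (λ _ → refl)) π))

  module EdgeSemantics (M : Frame σ) {n m : ℕ} (a : Vec (Dom M) m)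
    (χ χᵢ χₒ : Frm {σ} n (suc (suc m))) where
   private
    κ   = edgeF χ χᵢ χₒ
    κ⁺  = insertF χ χᵢ χₒ
    κ⁻  = deleteF χ χᵢ χₒ

   Edge : Dom M → Dom M → Set
   Edge x y = Holds M χ (x ∷ y ∷ a) × Holds M χᵢ (x ∷ x ∷ a) × Holds M χₒ (y ∷ y ∷ a)

   private
    at : ∀ s t (ψ : Frm n (suc (suc m))) {x y} → Holds M (inst₂ s t ψ) (x ∷ y ∷ a)
      ⇔ Holds M ψ (lookup (x ∷ y ∷ a) s ∷ lookup (x ∷ y ∷ a) t ∷ a)
    at s t ψ = Holds-inst M s t ψ (λ _ → refl)

   Holds-edge : ∀ {x y} → Holds M κ (x ∷ y ∷ a) ⇔ Edge x y
   Holds-edge = mk⇔ id id ×-⇔ (at zero zero χᵢ ×-⇔ at (suc zero) (suc zero) χₒ)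

   -- The pair (x, q) no longer crosses once q is added, hence the first disjunct. Any other y stays
   -- outside and then also forms a crossing pair with q.
   Holds-insert : ∀ q {x y} → Holds M (κ⁺ q) (x ∷ y ∷ a) ⇔
     ((y ≡ lookup a q ⊎ (Edge x y × Edge (lookup a q) y)) ×
      Holds M χᵢ (x ∷ x ∷ a) × Holds M χᵢ (lookup a q ∷ lookup a q ∷ a))
   Holds-insert q =
     ((mk⇔ id id ⊎-⇔ (Holds-edge ×-⇔ (Holds-edge ⇔-∘ at (suc (suc q)) (suc zero) κ))) ⇔-∘
       Holds-or M (eqF (suc zero) (suc (suc q))) (andF κ (inst₂ (suc (suc q)) (suc zero) κ)))
     ×-⇔ (at zero zero χᵢ ×-⇔ at (suc (suc q)) (suc (suc q)) χᵢ)

   Holds-delete : ∀ q {x y} → Holds M (κ⁻ q) (x ∷ y ∷ a) ⇔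
     ((x ≡ lookup a q ⊎ (Edge x y × Edge x (lookup a q))) ×
      Holds M χₒ (y ∷ y ∷ a) × Holds M χₒ (lookup a q ∷ lookup a q ∷ a))
   Holds-delete q =
     ((mk⇔ id id ⊎-⇔ (Holds-edge ×-⇔ (Holds-edge ⇔-∘ at zero (suc (suc q)) κ))) ⇔-∘
       Holds-or M (eqF zero (suc (suc q))) (andF κ (inst₂ zero (suc (suc q)) κ)))
     ×-⇔ (at (suc zero) (suc zero) χₒ ×-⇔ at (suc (suc q)) (suc (suc q)) χₒ)

  -- Answering a cut of M by a cut of N.

  module _ {M N : Frame σ} (hM : IsHenkin M) (hN : IsHenkin N) {n m : ℕ}
    {a : Vec (Dom M) m} {b : Vec (Dom N) m} {χ χᵢ χₒ : Frm {σ} n (suc (suc m))} where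

   private
    κ   = edgeF χ χᵢ χₒ
    κ⁺  = insertF χ χᵢ χₒ
    κ⁻  = deleteF χ χᵢ χₒ
    module ℳ = EdgeSemantics M a χ χᵢ χₒ
    module 𝒩 = EdgeSemantics N b χ χᵢ χₒ

    Transfer : Frm (suc n) m → Set
    Transfer δ = Holds M δ a ⇔ Holds N δ b

    CutN : Set₁
    CutN = ∃[ A ] Admits N A × Cut N b χ χᵢ χₒ A

    reach : ∀ {F : Frame σ} {c : Vec (Dom F) m} (κ : Frm n (suc (suc m))) p x →
      Holds F (pathF κ suc (suc p) zero) (x ∷ c) ⇔ Path F c κ (lookup c p) x
    reach {F} {c} κ p x = Holds-path F c κ (suc p) zero (λ _ → refl)

    coreach : ∀ {F : Frame σ} {c : Vec (Dom F) m} (κ : Frm n (suc (suc m))) p x →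
      Holds F (pathF κ suc zero (suc p)) (x ∷ c) ⇔ Path F c κ x (lookup c p)
    coreach {F} {c} κ p x = Holds-path F c κ zero (suc p) (λ _ → refl)

   module _ {A : Dom M → Set} (adm : Admits M A) (cut : Cut M a χ χᵢ χₒ A) where
    open Cut cut

    private
      edges : Crosses M a κ A
      edges x∈ y∉ = from ℳ.Holds-edge (cross x∈ y∉ , inside x∈ , outside y∉)

    -- The answer is the set reachable from p. The pairs (x, q) and (p, y) cross it and yield the
    -- diagonal conditions.
    cut-separated : ∀ p q → Transfer (pathF κ id p q) →
      A (lookup a p) → ¬ A (lookup a q) → CutN
    cut-separated p q e p∈ q∉ = R , definable hN (pathF κ suc (suc p) zero) b (reach κ p) , record
      { cross   = λ x∈ y∉ → proj₁ (edge x∈ y∉)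
      ; inside  = λ x∈ → proj₁ (proj₂ (edge x∈ ¬pq))
      ; outside = λ y∉ → proj₂ (proj₂ (edge (Path-refl N b κ) y∉))
      }
      where
      R : Dom N → Set
      R = Path N b κ (lookup b p)
      ¬pq : ¬ R (lookup b q)
      ¬pq = separate κ p q adm e edges p∈ q∉
      edge : ∀ {x y} → R x → ¬ R y → 𝒩.Edge x y
      edge x∈ y∉ = to 𝒩.Holds-edge (Crosses-reach κ x∈ y∉)

    -- A is replaced by the definable hull H ⊆ A of {p , q}, so that H ∖ {q} is
    -- admissible and separates p from q.
    cut-insert : ∀ p q → Transfer (pathF (κ⁺ q) id p q) → lookup a p ≢ lookup a q →
      A (lookup a p) → A (lookup a q) → CutN
    cut-insert p q e p≢q p∈ q∈ = R⁺
      , definable hN (orF (pathF (κ⁺ q) suc (suc p) zero) (eqF zero (suc q))) b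
          (λ x → (reach (κ⁺ q) p x ⊎-⇔ mk⇔ id id) ⇔-∘
            Holds-or N (pathF (κ⁺ q) suc (suc p) zero) (eqF zero (suc q)))
      , record
      { cross   = λ { (inj₁ x∈) y∉ → proj₁ (proj₁ (edge x∈ y∉))
                    -- For the added point q, the crossing pair (p, y) carries the edge (q, y).
                    ; (inj₂ refl) y∉ → proj₁ (proj₂ (edge (Path-refl N b (κ⁺ q)) y∉)) }
      ; inside  = λ { (inj₁ x∈) → proj₁ (proj₂ (insert x∈ ¬pq))
                    ; (inj₂ refl) → proj₂ (proj₂ (insert (Path-refl N b (κ⁺ q)) ¬pq)) }
      ; outside = λ y∉ → proj₂ (proj₂ (proj₁ (edge (Path-refl N b (κ⁺ q)) y∉)))
      }
      where
      H H⁻ : Dom M → Set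
      H x = Path M a κ (lookup a p) x ⊎ Path M a κ (lookup a q) x
      H⁻ x = H x × x ≢ lookup a q

      H⊆A : ∀ {x} → H x → A x
      H⊆A = [ (λ π → Path-least κ adm edges π p∈) , (λ π → Path-least κ adm edges π q∈) ]′

      H-edges : ∀ {x y} → H x → ¬ H y → ℳ.Edge x y
      H-edges x∈ y∉ = to ℳ.Holds-edge (stable λ ¬κ → y∉
        ([ (λ π → inj₁ (Path-∷ʳ M a κ π ¬κ)) , (λ π → inj₂ (Path-∷ʳ M a κ π ¬κ)) ]′ x∈))

      H⁻-adm : Admits M H⁻
      H⁻-adm = definable hM
        (andF (orF (pathF κ suc (suc p) zero) (pathF κ suc (suc q) zero)) (negF (eqF zero (suc q)))) a
        (λ x → ((reach κ p x ⊎-⇔ reach κ q x) ⇔-∘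
                  Holds-or M (pathF κ suc (suc p) zero) (pathF κ suc (suc q) zero))
               ×-⇔ mk⇔ id id)

      H⁻-crosses : Crosses M a (κ⁺ q) H⁻
      H⁻-crosses {x} {y} (x∈ , _) y∉ = from (ℳ.Holds-insert q) (new , inside (H⊆A x∈) , inside q∈)
        where
        new : y ≡ lookup a q ⊎ (ℳ.Edge x y × ℳ.Edge (lookup a q) y)
        new with em {y ≡ lookup a q}
        ... | yes y≡q = inj₁ y≡q
        -- Here y lies outside H, while x and q both lie in H.
        ... | no  y≢q = inj₂ (H-edges x∈ y∉H , H-edges (inj₂ (Path-refl M a κ)) y∉H)
          where y∉H = λ y∈ → y∉ (y∈ , y≢q)

      R R⁺ : Dom N → Set
      R = Path N b (κ⁺ q) (lookup b p)
      R⁺ x = R x ⊎ x ≡ lookup b q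

      ¬pq : ¬ R (lookup b q)
      -- Distinctness of the parameters keeps p in `H⁻` when q is removed.
      ¬pq = separate (κ⁺ q) p q H⁻-adm e H⁻-crosses
        (inj₁ (Path-refl M a κ) , p≢q) (λ (_ , q≢q) → q≢q refl)

      insert : ∀ {x y} → R x → ¬ R y → _
      insert {x} {y} x∈ y∉ = to (𝒩.Holds-insert q {x} {y}) (Crosses-reach (κ⁺ q) x∈ y∉)

      edge : ∀ {x y} → R x → ¬ R⁺ y → _
      edge x∈ y∉ = [ ⊥-elim ∘ y∉ ∘ inj₂ , id ]′ (proj₁ (insert x∈ (y∉ ∘ inj₁)))

    -- A is replaced by the complement H ⊇ A of the points leading to p or q, and H ∪ {q}
    -- separates q from p.
    cut-delete : ∀ p q → Transfer (pathF (κ⁻ q) id q p) → lookup a p ≢ lookup a q →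
      ¬ A (lookup a p) → ¬ A (lookup a q) → CutN
    cut-delete p q e p≢q p∉ q∉ = R⁻
      , definable hN (andF (pathF (κ⁻ q) suc (suc q) zero) (negF (eqF zero (suc q)))) b
          (λ x → reach (κ⁻ q) q x ×-⇔ mk⇔ id id)
      , record
      { cross   = cross′
      ; inside  = λ x∈ → proj₁ (proj₂ (proj₁ (edge x∈ ¬qp)))
      ; outside = outside′
      }
      where
      L H H⁺ : Dom M → Set
      L x = Path M a κ x (lookup a p) ⊎ Path M a κ x (lookup a q)
      H x = ¬ L x
      H⁺ x = H x ⊎ x ≡ lookup a q

      A⊆H : ∀ {x} → A x → H x
      A⊆H x∈ = [ (λ π → p∉ (Path-least κ adm edges π x∈)) , (λ π → q∉ (Path-least κ adm edges π x∈)) ]′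

      H-edges : ∀ {x y} → H x → L y → ℳ.Edge x y
      H-edges x∈ y∉ = to ℳ.Holds-edge (stable λ ¬κ → x∈
        ([ (λ π → inj₁ (Path-∷ M a κ ¬κ π)) , (λ π → inj₂ (Path-∷ M a κ ¬κ π)) ]′ y∉))

      LF : Frm (suc n) (suc m)
      LF = orF (pathF κ suc zero (suc p)) (pathF κ suc zero (suc q))

      H⁺-adm : Admits M H⁺
      H⁺-adm = definable hM (orF (negF LF) (eqF zero (suc q))) a
        (λ x → (neg-⇔ ((coreach κ p x ⊎-⇔ coreach κ q x) ⇔-∘
                        Holds-or M (pathF κ suc zero (suc p)) (pathF κ suc zero (suc q)))
               ⊎-⇔ mk⇔ id id) ⇔-∘ Holds-or M (negF LF) (eqF zero (suc q)))

      H⁺-crosses : Crosses M a (κ⁻ q) H⁺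
      H⁺-crosses {x} {y} x∈ y∉ = from (ℳ.Holds-delete q) (new , outside (y∉ ∘ inj₁ ∘ A⊆H) , outside q∉)
        where
        new : x ≡ lookup a q ⊎ (ℳ.Edge x y × ℳ.Edge x (lookup a q))
        new = [ (λ x∈H → inj₂ (H-edges x∈H (stable (y∉ ∘ inj₁)) ,
                               H-edges x∈H (inj₂ (Path-refl M a κ))))
              , inj₁ ]′ x∈

      R R⁻ : Dom N → Set
      R = Path N b (κ⁻ q) (lookup b q)
      R⁻ x = R x × x ≢ lookup b q

      ¬qp : ¬ R (lookup b p)
      -- `H⁺` contains q and misses p, since p lies in L and differs from q.
      ¬qp = separate (κ⁻ q) q p H⁺-adm e H⁺-crosses (inj₂ refl)
        [ (λ p∈H → p∈H (inj₁ (Path-refl M a κ))) , p≢q ]′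

      delete : ∀ {x y} → R x → ¬ R y → _
      delete {x} {y} x∈ y∉ = to (𝒩.Holds-delete q {x} {y}) (Crosses-reach (κ⁻ q) x∈ y∉)

      edge : ∀ {x y} → R⁻ x → ¬ R y → _
      edge (x∈ , x≢q) y∉ = [ ⊥-elim ∘ x≢q , id ]′ (proj₁ (delete x∈ y∉))

      cross′ : Crosses N b χ R⁻
      cross′ {x} {y} x∈ y∉ with em {R y}
      ... | no ¬Ry = proj₁ (proj₁ (edge x∈ ¬Ry))
      -- The only point of R outside `R⁻` is q, and the pair (x, p) carries the edge (x, q).
      ... | yes Ry with refl ← stable (λ y≢q → y∉ (Ry , y≢q)) = proj₁ (proj₂ (edge x∈ ¬qp))

      outside′ : ∀ {y} → ¬ R⁻ y → Holds N χₒ (y ∷ y ∷ b)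
      outside′ {y} y∉ with em {R y}
      ... | no ¬Ry = proj₁ (proj₂ (delete (Path-refl N b (κ⁻ q)) ¬Ry))
      ... | yes Ry with refl ← stable (λ y≢q → y∉ (Ry , y≢q)) =
        proj₂ (proj₂ (delete (Path-refl N b (κ⁻ q)) ¬qp))

    -- The whole domain of N answers: only the inside condition has content, and `diagF` transfers
    -- it.
    cut-all : (∀ x → A x) → Transfer (diagF χᵢ) → CutN
    cut-all all e = (λ x → x ≡ x) , definable hN {n} ⊤F b (λ x → mk⇔ id id) , record
      { cross   = λ _ y∉ → ⊥-elim (y∉ refl)
      ; inside  = λ {x} _ → to (Holds-diag N χᵢ {b})
          (to e (from (Holds-diag M χᵢ) λ x → inside (all x))) x
      ; outside = λ y∉ → ⊥-elim (y∉ refl)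
      }

    cut-none : (∀ x → ¬ A x) → Transfer (diagF χₒ) → CutN
    cut-none none e = (λ x → x ≢ x) , definable hN {n} (negF ⊤F) b (λ x → mk⇔ id id) , record
      { cross   = λ x∈ _ → ⊥-elim (x∈ refl)
      ; inside  = λ x∈ → ⊥-elim (x∈ refl)
      ; outside = λ {y} _ → to (Holds-diag N χₒ {b})
          (to e (from (Holds-diag M χₒ) λ x → outside (none x))) y
      }

    cut-transfer : ∀ {B} → Agree (cutFrms B) M a N b → GoodParams (Dom M) a →
      χ ∈ B → χᵢ ∈ B → χₒ ∈ B → CutN
    cut-transfer {B} ag good χ∈ χᵢ∈ χₒ∈ with em {∀ x → A x} | em {∀ x → ¬ A x} | good
    ... | yes all | _ | _ = cut-all all (holds⇔ ag (∈-++⁺ˡ (∈-map⁺ diagF χᵢ∈)))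
    ... | no _ | yes none | _ = cut-none none (holds⇔ ag (∈-++⁺ˡ (∈-map⁺ diagF χₒ∈)))
    -- A subset of a one-element domain is empty or everything.
    ... | no ¬all | no ¬none | inj₂ (c , only) = ⊥-elim (¬none λ x x∈ → ¬all λ y →
      subst A (trans (only x) (sym (only y))) x∈)
    ... | no ¬all | no ¬none | inj₁ (p , q , p≢q) = by-params em em
      where
      quint∈ : ∀ p q → ((χ , χᵢ , χₒ) , p , q) ∈ quintuples B
      quint∈ p q = ∈-cartesianProduct⁺ (∈-cartesianProduct⁺ χ∈ (∈-cartesianProduct⁺ χᵢ∈ χₒ∈))
                                       (∈-cartesianProduct⁺ (∈-allFin p) (∈-allFin q))
      pathFrms : Agree (List.map edgePath (quintuples B) List.++
        List.map insertPath (quintuples B) List.++ List.map deletePath (quintuples B)) M a N b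
      pathFrms = Agree-⊆ (∈-++⁺ʳ (List.map diagF B)) ag

      by-params : Dec (A (lookup a p)) → Dec (A (lookup a q)) → CutN
      by-params (yes p∈) (no q∉) = cut-separated p q
        (holds⇔ pathFrms (∈-++⁺ˡ (∈-map⁺ edgePath (quint∈ p q)))) p∈ q∉
      by-params (no p∉) (yes q∈) = cut-separated q p
        (holds⇔ pathFrms (∈-++⁺ˡ (∈-map⁺ edgePath (quint∈ q p)))) q∈ p∉
      by-params (yes p∈) (yes q∈) = cut-insert p q
        (holds⇔ pathFrms (∈-++⁺ʳ (List.map edgePath (quintuples B))
          (∈-++⁺ˡ (∈-map⁺ insertPath (quint∈ p q))))) p≢q p∈ q∈
      by-params (no p∉) (no q∉) = cut-delete p q
        (holds⇔ pathFrms (∈-++⁺ʳ (List.map edgePath (quintuples B))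
          (∈-++⁺ʳ (List.map insertPath (quintuples B)) (∈-map⁺ deletePath (quint∈ p q))))) p≢q p∉ q∉

  -- Matching elements and pairs around an answered set.

  module _ {M N : Frame σ} {n m : ℕ} (Δ : List (Frm {σ} n (suc (suc m))))
    (a : Vec (Dom M) m) (b : Vec (Dom N) m) where

    -- The matching runs backwards: what occurs around B occurs around A. This lets closedness pass
    -- from A to B.
    record Response (A : Dom M → Set) (B : Dom N → Set) : Set where
      field
        cross   : ∀ {x′ y′} → B x′ → ¬ B y′ →
          ∃[ x ] ∃[ y ] A x × ¬ A y × Agree Δ M (x ∷ y ∷ a) N (x′ ∷ y′ ∷ b)
        inside  : ∀ {x′} → B x′ → ∃[ x ] A x × Agree Δ M (x ∷ x ∷ a) N (x′ ∷ x′ ∷ b)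
        outside : ∀ {y′} → ¬ B y′ → ∃[ y ] ¬ A y × Agree Δ M (y ∷ y ∷ a) N (y′ ∷ y′ ∷ b)

    -- The three formulas are the unions of the types realised around the given set, so that set is
    -- a cut by construction. In the answering cut `typeSet` turns each formula back into a realised
    -- type.
    respond : IsHenkin M → IsHenkin N → GoodParams (Dom M) a →
      Agree (cutFrms (typeSets Δ)) M a N b →
      ∀ i → ∃[ i′ ] Response (Adm M i) (Adm N i′)
    respond hM hN good ag i
      with typeSet Δ M (λ g → ∃[ x ] ∃[ y ] g ≡ x ∷ y ∷ a × Adm M i x × ¬ Adm M i y)
         | typeSet Δ M (λ g → ∃[ x ] g ≡ x ∷ x ∷ a × Adm M i x)
         | typeSet Δ M (λ g → ∃[ y ] g ≡ y ∷ y ∷ a × ¬ Adm M i y)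
    ... | χ , χ∈ , s , r | χᵢ , χᵢ∈ , sᵢ , rᵢ | χₒ , χₒ∈ , sₒ , rₒ
      with cut-transfer hM hN {χ = χ} {χᵢ} {χₒ} (i , λ _ → mk⇔ id id)
             record { cross   = λ x∈ y∉ → s (_ , _ , refl , x∈ , y∉)
                    ; inside  = λ x∈ → sᵢ (_ , refl , x∈)
                    ; outside = λ y∉ → sₒ (_ , refl , y∉) }
             ag good χ∈ χᵢ∈ χₒ∈
    ... | B , (i′ , e) , c = i′ , record
      { cross   = λ x∈ y∉ → unpack₂ (r N (Cut.cross c′ x∈ y∉))
      ; inside  = λ x∈ → unpack (rᵢ N (Cut.inside c′ x∈))
      ; outside = λ y∉ → unpack (rₒ N (Cut.outside c′ y∉))
      }
      where
      c′ = Cut-resp N b (λ x → ⇔-sym (e x)) c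
      unpack : ∀ {P : Dom M → Set} {h} →
        ∃[ g ] (∃[ x ] g ≡ x ∷ x ∷ a × P x) × Agree Δ M g N h →
        ∃[ x ] P x × Agree Δ M (x ∷ x ∷ a) N h
      unpack (_ , (x , refl , p) , ag) = x , p , ag
      unpack₂ : ∀ {P Q : Dom M → Set} {h} →
        ∃[ g ] (∃[ x ] ∃[ y ] g ≡ x ∷ y ∷ a × P x × Q y) × Agree Δ M g N h →
        ∃[ x ] ∃[ y ] P x × Q y × Agree Δ M (x ∷ y ∷ a) N h
      unpack₂ (_ , (x , y , refl , p , q) , ag) = x , y , p , q , ag

    module _ {A : Dom M → Set} {B : Dom N → Set} (R : Response A B) where
      open Response R

      -- A component contributes a crossing pair or one element taken twice. In the second case the
      -- element is matched from inside or from outside, according to its side of B.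
      answer : ∀ x′ y′ → x′ ≡ y′ ⊎ (B x′ × ¬ B y′) →
        ∃[ x ] ∃[ y ] Agree Δ M (x ∷ y ∷ a) N (x′ ∷ y′ ∷ b) × (B x′ → A x) × (¬ B y′ → ¬ A y)
      answer x′ y′ (inj₂ (x′∈ , y′∉)) with cross x′∈ y′∉
      ... | x , y , x∈ , y∉ , ag = x , y , ag , (λ _ → x∈) , (λ _ → y∉)
      answer x′ _ (inj₁ refl) with em {B x′}
      ... | yes x′∈ = let (x , x∈ , ag) = inside x′∈ in
        x , x , ag , (λ _ → x∈) , (λ x′∉ → ⊥-elim (x′∉ x′∈))
      ... | no  x′∉ = let (x , x∉ , ag) = outside x′∉ in
        x , x , ag , (λ x′∈ → ⊥-elim (x′∉ x′∈)) , (λ _ → x∉)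

      -- An element matched with the j-th parameter satisfies its marker, hence is the j-th
      -- parameter on the other side.
      params : (∀ {δ} → δ ∈ markers m → δ ∈ Δ) → ∀ j → A (lookup a j) ⇔ B (lookup b j)
      params sub j = mk⇔
        (λ j∈ → stable λ j∉ → let (y , y∉ , ag) = outside j∉ in
          y∉ (subst A (sym (from (holds⇔ ag marker) refl)) j∈))
        (λ j∈ → let (x , x∈ , ag) = inside j∈ in subst A (from (holds⇔ ag marker) refl) x∈)
        where
        marker : eqF zero (suc (suc j)) ∈ Δ
        marker = sub (∈-map⁺ (λ j → eqF zero (suc (suc j))) (∈-allFin j))

-- Families of elements and parameters across components.

module Families {k : ℕ} where

  put : {D : Fin k → Set} (i : Fin k) → D i → (∀ t → D t) → ∀ t → D t
  put i x d t with i ≟ t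
  ... | yes refl = x
  ... | no _     = d t

  put-same : ∀ {D : Fin k → Set} i (x : D i) d → put {D} i x d i ≡ x
  put-same i x d with i ≟ i
  ... | yes refl = refl
  ... | no i≢i   = ⊥-elim (i≢i refl)

  put-other : ∀ {D : Fin k → Set} i (x : D i) d {t} → i ≢ t → put {D} i x d t ≡ d t
  put-other i x d {t} i≢t with i ≟ t
  ... | yes i≡t = ⊥-elim (i≢t i≡t)
  ... | no _    = refl

  -- If i and j differ, one family contains both endpoints and serves twice. If they coincide, the
  -- two families differ in that component only, by a crossing pair.
  put-pair : ∀ {D : Fin k → Set} (d : ∀ t → D t) (A : ∀ t → D t → Set) i j (x : D i) (y : D j) →
    A i x → ¬ A j y →
    Σ[ x̂ ∈ (∀ t → D t) ] Σ[ ŷ ∈ (∀ t → D t) ] x̂ i ≡ x × ŷ j ≡ y ×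
      (∀ t → x̂ t ≡ ŷ t ⊎ (A t (x̂ t) × ¬ A t (ŷ t)))
  put-pair {D} d A i j x y x∈ y∉ with i ≟ j
  ... | no i≢j = f , f , trans (put-other j y (put i x d) (i≢j ∘ sym)) (put-same i x d)
               , put-same j y (put i x d) , λ t → inj₁ refl
    where
    f : ∀ t → D t
    f = put j y (put i x d)
  ... | yes refl = put i x d , put i y d , put-same i x d , put-same i y d , pair
    where
    pair : ∀ t → put {D} i x d t ≡ put i y d t ⊎ (A t (put i x d t) × ¬ A t (put i y d t))
    pair t with i ≟ t
    ... | yes refl = inj₂ (x∈ , y∉)
    ... | no _     = inj₁ refl

  module _ {D E : Fin k → Set} {m : Fin k → ℕ} where

    -- Entries are tied to positions in the component tuples, independently of the order of
    -- concatenation.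
    record Follows (a : ∀ i → Vec (D i) (m i)) (b : ∀ i → Vec (E i) (m i))
      {s} (g : Vec (Σ (Fin k) D) s) (h : Vec (Σ (Fin k) E) s) : Set where
      constructor follows
      field
        param : ∀ j → ∃[ i ] Σ[ p ∈ Fin (m i) ]
          lookup g j ≡ (i , lookup (a i) p) × lookup h j ≡ (i , lookup (b i) p)
    open Follows public

    module _ {a : ∀ i → Vec (D i) (m i)} {b : ∀ i → Vec (E i) (m i)} where

      Follows-select : ∀ {s r g h} (xs : Vec (Fin s) r) → Follows a b g h →
        Follows a b (map (lookup g) xs) (map (lookup h) xs)
      Follows-select {g = g} {h} xs fo = follows λ j →
        let (i , p , e , e′) = param fo (lookup xs j) in
        i , p , trans (lookup-map j (lookup g) xs) e , trans (lookup-map j (lookup h) xs) e′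

      -- Turns an atom of the disjoint union into an atom of component i over its own parameters.
      Follows-component : ∀ {r} {g : Vec _ r} {h} {i} (ds : Vec (D i) r) → Follows a b g h →
        g ≡ map (i ,_) ds →
        Σ[ ps ∈ Vec (Fin (m i)) r ] ds ≡ map (lookup (a i)) ps × h ≡ map (i ,_) (map (lookup (b i)) ps)
      Follows-component {h = []} [] fo refl = [] , refl , refl
      Follows-component {h = _ ∷ h} (d ∷ ds) fo refl with param fo zero
      ... | i , p , refl , refl with Follows-component {h = h} ds (follows (param fo ∘ suc)) refl
      ... | ps , refl , refl = p ∷ ps , refl , refl

  -- Every component tuple grows by one, whichever component holds the new entry.
  Follows-∷ : ∀ {D E : Fin k → Set} {m : Fin k → ℕ}
    {a : ∀ i → Vec (D i) (m i)} {b : ∀ i → Vec (E i) (m i)} {s} {g : Vec _ s} {h}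
    (x : ∀ i → D i) (y : ∀ i → E i) → Follows a b g h →
    ∀ i → Follows (λ i → x i ∷ a i) (λ i → y i ∷ b i) ((i , x i) ∷ g) ((i , y i) ∷ h)
  Follows-∷ x y fo i = follows λ
    { zero    → i , zero , refl , refl
    ; (suc j) → let (i , p , e , e′) = param fo j in i , suc p , e , e′ }

  Follows-sym : ∀ {D E : Fin k → Set} {m : Fin k → ℕ}
    {a : ∀ i → Vec (D i) (m i)} {b : ∀ i → Vec (E i) (m i)} {s} {g : Vec _ s} {h} →
    Follows a b g h → Follows b a h g
  Follows-sym fo = follows λ j → let (i , p , e , e′) = param fo j in i , p , e′ , e

open Families

concatParams-follows : ∀ k {D E : Fin k → Set} {m : Fin k → ℕ}
  (a : ∀ i → Vec (D i) (m i)) (b : ∀ i → Vec (E i) (m i)) →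
  Follows a b (concatParams k D m a) (concatParams k E m b)
concatParams-follows zero a b = follows λ ()
concatParams-follows (suc k) {D} {E} {m} a b = follows at
  where
  a₊ = concatParams k (D ∘ suc) (m ∘ suc) (a ∘ suc)
  b₊ = concatParams k (E ∘ suc) (m ∘ suc) (b ∘ suc)

  head : ∀ {F : Fin (suc k) → Set} → F zero → Σ (Fin (suc k)) F
  head x = zero , x
  shift : ∀ {F : Fin (suc k) → Set} → Σ (Fin k) (F ∘ suc) → Σ (Fin (suc k)) F
  shift p = suc (proj₁ p) , proj₂ p

  at : ∀ j → ∃[ i ] Σ[ p ∈ Fin (m i) ]
    lookup (map (head {D}) (a zero) ++ map (shift {D}) a₊) j ≡ (i , lookup (a i) p) ×
    lookup (map (head {E}) (b zero) ++ map (shift {E}) b₊) j ≡ (i , lookup (b i) p)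
  at j rewrite lookup-splitAt (m zero) (map (head {D}) (a zero)) (map (shift {D}) a₊) j
             | lookup-splitAt (m zero) (map (head {E}) (b zero)) (map (shift {E}) b₊) j
    with splitAt (m zero) j
  ... | inj₁ p = zero , p , lookup-map p head (a zero) , lookup-map p head (b zero)
  ... | inj₂ j′ with param (concatParams-follows k (a ∘ suc) (b ∘ suc)) j′
  ... | i , p , e , e′ = suc i , p , trans (lookup-map j′ shift a₊) (cong shift e)
                                   , trans (lookup-map j′ shift b₊) (cong shift e′)

-- Supplies the default that pads components without a chosen element.
element : ∀ {D : Set} {m} (a : Vec D m) → GoodParams D a → D
element a (inj₁ (p , _)) = lookup a p
element a (inj₂ (c , _)) = c

GoodParams-∷ : ∀ {D : Set} {m} {a : Vec D m} x → GoodParams D a → GoodParams D (x ∷ a)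
GoodParams-∷ x (inj₁ (p , q , p≢q)) = inj₁ (suc p , suc q , p≢q)
GoodParams-∷ x (inj₂ c)             = inj₂ c

-- Transfer of formulas from one fusion to the other.

module Composition (em : ExcludedMiddle 0ℓ) {σ : Signature} {k : ℕ} (f : FusionMap σ k) where
  open Stability em
  open Classical em

  eqFrms : ∀ {n} m → List (Frm {σ} n m)
  eqFrms m = cartesianProductWith eqF (allFin m) (allFin m)

  matrixFrms : ∀ {r} → QF σ k r → ∀ {n} m → List (Frm {σ} n m)
  matrixFrms (qrel P xs) m = List.map (relF P) (allVecs m (arity σ P))
  -- The component of an entry is already fixed by `Follows`.
  matrixFrms (qQ i x)    m = []
  matrixFrms (qeq x y)   m = eqFrms m
  matrixFrms (qneg φ)    m = matrixFrms φ m
  matrixFrms (qand φ ψ)  m = matrixFrms φ m List.++ matrixFrms ψ m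

  -- The lists do not depend on the structures. The scope m counts the parameters of a component,
  -- separately from the scope s of φ.
  frms : ∀ {s} (φ : Fm σ s) {n} → qd φ ≤ n → ∀ m → List (Frm {σ} n m)
  frms (rel P xs) q m = matrixFrms (f P) m
  frms (eq x y) q m = eqFrms m
  frms (neg φ) q m = frms φ q m
  frms (and φ ψ) q m = frms φ (≤-trans (m≤m⊔n (qd φ) (qd ψ)) q) m List.++
                       frms ψ (≤-trans (m≤n⊔m (qd φ) (qd ψ)) q) m
  frms (ex φ) (s≤s q) m = List.map exF (typeSets (frms φ q (suc m)))
  frms (tc φ u v) (s≤s q) m = cutFrms (typeSets (markers m List.++ frms φ q (suc (suc m))))

  AgreeAll : ∀ {n} {m : Fin k → ℕ} → (∀ m → List (Frm n m)) →
    (M : Fin k → Frame σ) → (∀ i → Vec (Dom (M i)) (m i)) →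
    (N : Fin k → Frame σ) → (∀ i → Vec (Dom (N i)) (m i)) → Set
  AgreeAll {m = m} Δ M a N b = ∀ i → Agree (Δ (m i)) (M i) (a i) (N i) (b i)

  module _ {n : ℕ} {m : Fin k → ℕ} where

    eq-transfer : ∀ (M N : Fin k → Frame σ)
      {a : ∀ i → Vec (Dom (M i)) (m i)} {b : ∀ i → Vec (Dom (N i)) (m i)} →
      AgreeAll (eqFrms {n}) M a N b →
      ∀ {s} {g : Vec _ s} {h} → Follows a b g h →
      ∀ x y → lookup g x ≡ lookup g y → lookup h x ≡ lookup h y
    eq-transfer M N ag fo x y e with param fo x | param fo y
    ... | i , p , x≡ , x≡′ | j , q , y≡ , y≡′ with trans (sym x≡) (trans e y≡)
    ... | same with cong proj₁ same
    ... | refl = trans x≡′ (trans (cong (i ,_) (to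
      (holds⇔ (ag i) (∈-cartesianProductWith⁺ eqF (∈-allFin p) (∈-allFin q)))
      (,-injectiveʳ-UIP uip same))) (sym y≡′))

    matrix-transfer : ∀ {r} (φ : QF σ k r) (M N : Fin k → Frame σ)
      {a : ∀ i → Vec (Dom (M i)) (m i)} {b : ∀ i → Vec (Dom (N i)) (m i)} →
      AgreeAll (matrixFrms φ {n}) M a N b →
      ∀ {g h} → Follows a b g h → SatU M φ g → SatU N φ h
    matrix-transfer (qrel P xs) M N {a} {b} ag fo (i , ds , e , d)
      with Follows-component ds (Follows-select xs fo) e
    ... | ps , refl , e′ =
      i , map (lookup (b i)) ps , e′ , to (holds⇔ (ag i) (∈-map⁺ (relF P) (∈-allVecs ps))) d
    matrix-transfer (qQ i x) M N ag fo refl with param fo x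
    ... | _ , _ , e , e′ = trans (cong proj₁ e′) (sym (cong proj₁ e))
    matrix-transfer (qeq x y) M N ag fo e = eq-transfer M N ag fo x y e
    matrix-transfer (qneg φ) M N ag fo ¬s s =
      ¬s (matrix-transfer φ N M (λ i → Agree-sym (ag i)) (Follows-sym fo) s)
    matrix-transfer (qand φ ψ) M N ag fo (s , t) =
      matrix-transfer φ M N (λ i → Agree-⊆ ∈-++⁺ˡ (ag i)) fo s ,
      matrix-transfer ψ M N (λ i → Agree-⊆ (∈-++⁺ʳ (matrixFrms φ (m i))) (ag i)) fo t

  -- One direction is proved for all M and N, so that negation can exchange the two sides.
  transfer : ∀ {s} (φ : Fm σ s) {n} (d : qd φ ≤ n) {m : Fin k → ℕ} (M N : Fin k → Frame σ) →
    (∀ i → IsHenkin (M i)) → (∀ i → IsHenkin (N i)) →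
    {a : ∀ i → Vec (Dom (M i)) (m i)} {b : ∀ i → Vec (Dom (N i)) (m i)} →
    (∀ i → GoodParams (Dom (M i)) (a i)) → (∀ i → GoodParams (Dom (N i)) (b i)) →
    AgreeAll (frms φ d) M a N b →
    ∀ {g h} → Follows a b g h → Sat (fusion f M) φ g → Sat (fusion f N) φ h
  transfer (rel P xs) d M N hM hN ga gb ag fo s = matrix-transfer (f P) M N ag (Follows-select xs fo) s
  transfer (eq x y) d M N hM hN ga gb ag fo s = eq-transfer M N ag fo x y s
  transfer (neg φ) d M N hM hN ga gb ag fo ¬s s =
    ¬s (transfer φ d N M hN hM gb ga (λ i → Agree-sym (ag i)) (Follows-sym fo) s)
  transfer (and φ ψ) d {m} M N hM hN ga gb ag fo (s , t) =
    transfer φ _ M N hM hN ga gb (λ i → Agree-⊆ ∈-++⁺ˡ (ag i)) fo s ,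
    transfer ψ _ M N hM hN ga gb (λ i → Agree-⊆ (∈-++⁺ʳ (frms φ _ (m i))) (ag i)) fo t
  transfer (ex φ) (s≤s d) {m} M N hM hN {a} {b} ga gb ag {g} {h} fo ((i , x) , s) =
    (i , y i) , transfer φ d M N hM hN (λ t → GoodParams-∷ _ (ga t)) (λ t → GoodParams-∷ _ (gb t))
      (λ t → proj₂ (ext t)) (Follows-∷ x̂ y fo i)
      (subst (λ x → Sat (fusion f M) φ ((i , x) ∷ g)) (sym (put-same i x (λ t → element (a t) (ga t)))) s)
    where
    -- The chosen x in component i, defaults elsewhere.
    x̂ : ∀ t → Dom (M t)
    x̂ = put i x (λ t → element (a t) (ga t))
    ext : ∀ t → ∃[ y ] Agree (frms φ d (suc (m t))) (M t) (x̂ t ∷ a t) (N t) (y ∷ b t)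
    ext t = extend (frms φ d (suc (m t))) (ag t) (x̂ t)
    y : ∀ t → Dom (N t)
    y t = proj₁ (ext t)
  transfer (tc φ u v) (s≤s d) {m} M N hM hN {a} {b} ga gb ag {g} {h} fo s I closed u∈ =
    to (params⇔ v) (s J closed′ (from (params⇔ u) u∈))
    where
    Δ : ∀ m → List (Frm _ (suc (suc m)))
    Δ m = markers m List.++ frms φ d (suc (suc m))

    -- The set to be tested lives in N, so each of its components is answered in M.
    resp : ∀ t → ∃[ j ] Response (Δ (m t)) (b t) (a t) (Adm (N t) (I t)) (Adm (M t) j)
    resp t = respond (Δ (m t)) (b t) (a t) (hN t) (hM t) (gb t) (Agree-sym (ag t)) (I t)

    J : ∀ t → Idx (M t)
    J t = proj₁ (resp t)

    admM : UDom M → Set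
    admM = Adm (fusion f M) J
    admN : UDom N → Set
    admN = Adm (fusion f N) I

    params⇔ : ∀ j → admM (lookup g j) ⇔ admN (lookup h j)
    params⇔ j = let (t , p , e , e′) = param fo j in
      subst₂ (λ x y → admM x ⇔ admN y) (sym e) (sym e′)
        (⇔-sym (params (Δ (m t)) (b t) (a t) (proj₂ (resp t)) ∈-++⁺ˡ p))

    module Crossing {i j : Fin k} (x̂ ŷ : ∀ t → Dom (M t))
      (pair : ∀ t → x̂ t ≡ ŷ t ⊎ (Adm (M t) (J t) (x̂ t) × ¬ Adm (M t) (J t) (ŷ t))) where

      ans : ∀ t → ∃[ x′ ] ∃[ y′ ] Agree (Δ (m t)) (N t) (x′ ∷ y′ ∷ b t) (M t) (x̂ t ∷ ŷ t ∷ a t) ×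
        (Adm (M t) (J t) (x̂ t) → Adm (N t) (I t) x′) × (¬ Adm (M t) (J t) (ŷ t) → ¬ Adm (N t) (I t) y′)
      ans t = answer (Δ (m t)) (b t) (a t) (proj₂ (resp t)) (x̂ t) (ŷ t) (pair t)

      x′ y′ : ∀ t → Dom (N t)
      x′ t = proj₁ (ans t)
      y′ t = proj₁ (proj₂ (ans t))

      edge : Sat (fusion f M) φ ((i , x̂ i) ∷ (j , ŷ j) ∷ g) →
             Sat (fusion f N) φ ((i , x′ i) ∷ (j , y′ j) ∷ h)
      edge = transfer φ d M N hM hN
        (λ t → GoodParams-∷ _ (GoodParams-∷ _ (ga t))) (λ t → GoodParams-∷ _ (GoodParams-∷ _ (gb t)))
        (λ t → Agree-⊆ (∈-++⁺ʳ (markers (m t))) (Agree-sym (proj₁ (proj₂ (proj₂ (ans t))))))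
        (Follows-∷ x̂ x′ (Follows-∷ ŷ y′ fo j) i)

      -- The source is read off in component i and the target in component j: `ans` puts the first
      -- inside I and the second outside, against closedness.
      refute : admM (i , x̂ i) → ¬ admM (j , ŷ j) → ¬ Sat (fusion f M) φ ((i , x̂ i) ∷ (j , ŷ j) ∷ g)
      refute x∈ y∉ sφ = proj₂ (proj₂ (proj₂ (proj₂ (ans j)))) y∉
        (closed (i , x′ i) (j , y′ j) (proj₁ (proj₂ (proj₂ (proj₂ (ans i)))) x∈) (edge sφ))

    closed′ : ∀ x y → admM x → Sat (fusion f M) φ (x ∷ y ∷ g) → admM y
    closed′ (i , x) (j , y) x∈ sφ = stable λ y∉ →
      let (x̂ , ŷ , x≡ , y≡ , pair) = put-pair
            (λ t → element (a t) (ga t)) (λ t → Adm (M t) (J t)) i j x y x∈ y∉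
      in Crossing.refute x̂ ŷ pair
           (subst (Adm (M i) (J i)) (sym x≡) x∈) (λ ŷ∈ → y∉ (subst (Adm (M j) (J j)) y≡ ŷ∈))
           (subst₂ (λ x y → Sat (fusion f M) φ ((i , x) ∷ (j , y) ∷ g)) (sym x≡) (sym y≡) sφ)

theorem5p27 : ExcludedMiddle 0ℓ →
    {σ : Signature} {k : ℕ} (f : FusionMap σ k)
    (M N : Fin k → Frame σ) →
    ((i : Fin k) → IsHenkin (M i)) → ((i : Fin k) → IsHenkin (N i)) →
    (m : Fin k → ℕ)
    (a : (i : Fin k) → Vec (Dom (M i)) (m i))
    (b : (i : Fin k) → Vec (Dom (N i)) (m i)) →
    ((i : Fin k) → GoodParams (Dom (M i)) (a i)) →
    ((i : Fin k) → GoodParams (Dom (N i)) (b i)) →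
    (n : ℕ) →
    ((i : Fin k) → EquivN n (M i) (a i) (N i) (b i)) →
    EquivN n (fusion f M) (concatParams k (λ i → Dom (M i)) m a)
    (fusion f N) (concatParams k (λ i → Dom (N i)) m b)
theorem5p27 em {σ} {k} f M N hM hN m a b ga gb n equiv φ d =
  transfer φ d M N hM hN ga gb agree′ (concatParams-follows k a b) ,
  transfer φ d N M hN hM gb ga (λ i → Agree-sym (agree′ i)) (concatParams-follows k b a)
  where
  open Composition em f
  agree′ : AgreeAll (frms φ d) M a N b
  agree′ i = agree λ { {ψ , p} _ → mk⇔ (proj₁ (equiv i ψ p)) (proj₂ (equiv i ψ p)) }
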